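{- Let $G$ be a connected chordal graph with at least two vertices. A vertex $v\in V(G)$ is an $\mathcal{F}$-branch leaf of some perfect elimination ordering of $G$ if and only if the induced subgraph $G[N_G(v)]$ has a dominating clique.
   Context: Graphs are finite, simple, undirected; $N_G(v)$ is the open neighborhood of $v$. A graph is chordal if it has no induced cycle of length at least 4. A clique $C$ of a graph $H$ is dominating if every vertex of $H$ is in $C$ or has a neighbor in $C$. A vertex ordering $\sigma$ of $G$ (a bijection $\{1,\dots,n\}\to V(G)$, with $u\prec_\sigma w$ meaning $u$ comes before $w$) is a perfect elimination ordering (PEO) if for every vertex $v$ the neighbors of $v$ that precede $v$ in $\sigma$ form a clique. For an ordering $\sigma$ of a connected graph in which every vertex other than $\sigma(1)$ has a neighbor to its left (as is the case for PEOs of connected chordal graphs), the $\mathcal{F}$-tree of $\sigma$ is the spanning tree containing, for each $v\neq\sigma(1)$, the edge from $v$ to its leftmost neighbor in $\sigma$. A vertex $v\neq\sigma(1)$ that is a leaf of the $\mathcal{F}$-tree is an $\mathcal{F}$-branch leaf of $\sigma$. -}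

module Defs where

open import Data.Bool.Base using (Bool; T)
open import Data.Fin.Base using (Fin; toℕ; _<_)
open import Data.Nat.Base using (ℕ; suc) renaming (_≤_ to _≤ⁿ_)
open import Data.Product using (Σ; ∃-syntax; ∃!; _×_; _,_; proj₁)
open import Data.Sum.Base using (_⊎_)
open import Function.Base using (_∘_; _on_)
open import Function.Bundles using (_↔_; _⇔_; Inverse)
open import Function.Definitions using (Injective)
open import Level using (0ℓ)
open import Relation.Binary.Core using (Rel)
open import Relation.Binary.Construct.Closure.ReflexiveTransitive using (Star)
open import Relation.Binary.Construct.Closure.Symmetric using (SymClosure)
open import Relation.Binary.Definitions using (Symmetric)
open import Relation.Binary.PropositionalEquality.Core using (_≡_; _≢_)
open import Relation.Nullary.Negation.Core using (¬_)
open import Relation.Unary using (Pred)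

-- Adjacency and vertex subsets are Boolean-valued.  Besides being decidable,
-- they are then proof-irrelevant, so that a vertex of an induced subgraph
-- (a vertex paired with a proof of membership) is determined by its first
-- component.  Finiteness of V is not part of the record.
record Graph (V : Set) : Set where
  field
    adj     : V → V → Bool
    symm    : ∀ {x y} → T (adj x y) → T (adj y x)
    irrefl  : ∀ {x} → ¬ T (adj x x)

  Adj : Rel V 0ℓ
  Adj x y = T (adj x y)

  N : V → V → Bool
  N v = adj v

open Graph public using (N)

induced : {V : Set} → Graph V → (S : V → Bool) → Graph (Σ V (T ∘ S))
induced G S = record
  { adj    = adj on proj₁
  ; symm   = symm
  ; irrefl = irrefl
  }
  where open Graph G

CyclicSuc : ∀ {k} → Rel (Fin k) 0ℓ
CyclicSuc {k} i j = suc (toℕ i) ≡ toℕ j ⊎ (suc (toℕ i) ≡ k × toℕ j ≡ 0)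

module _ {V : Set} (G : Graph V) where
  open Graph G using (Adj)

  Connected : Set
  Connected = ∀ x y → Star Adj x y

  record InducedCycle (k : ℕ) : Set where
    field
      vertex    : Fin k → V
      injective : Injective _≡_ _≡_ vertex
      adjacency : ∀ i j → Adj (vertex i) (vertex j) ⇔ SymClosure CyclicSuc i j

  Chordal : Set
  Chordal = ∀ k → 4 ≤ⁿ k → ¬ InducedCycle k

  IsClique : Pred V 0ℓ → Set
  IsClique C = ∀ {x y} → C x → C y → x ≢ y → Adj x y

  IsDominating : Pred V 0ℓ → Set
  IsDominating C = ∀ x → C x ⊎ (∃[ y ] (C y × Adj x y))

  HasDominatingClique : Set
  HasDominatingClique =
    Σ (V → Bool) λ C → IsClique (T ∘ C) × IsDominating (T ∘ C)

-- The i-th vertex of σ is  to σ i ; positions are counted from 0.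
Ordering : Set → ℕ → Set
Ordering V n = Fin n ↔ V

module _ {V : Set} {n : ℕ} (σ : Ordering V n) where

  position : V → Fin n
  position = Inverse.from σ

  Precedes : Rel V 0ℓ
  Precedes = _<_ on position

  IsFirst : Pred V 0ℓ
  IsFirst v = toℕ (position v) ≡ 0

module _ {V : Set} (G : Graph V) {n : ℕ} (σ : Ordering V n) where
  open Graph G using (Adj)

  IsPEO : Set
  IsPEO = ∀ v → IsClique G (λ u → Adj v u × Precedes σ u v)

  IsLeftmostNeighbor : Rel V 0ℓ
  IsLeftmostNeighbor v u = Adj v u × (∀ w → Adj v w → ¬ Precedes σ w u)

  -- For a PEO of a connected graph the leftmost neighbor of a non-first vertex
  -- precedes it, so these n ∸ 1 edges form a spanning tree.
  FTree : Rel V 0ℓ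
  FTree = SymClosure (λ v u → ¬ IsFirst σ v × IsLeftmostNeighbor v u)

  IsFBranchLeaf : Pred V 0ℓ
  IsFBranchLeaf v = ¬ IsFirst σ v × ∃! _≡_ (FTree v)

{-# OPTIONS --safe #-}

-- If v is a leaf, its left neighbours form a clique, and they dominate N(v): a right
-- neighbour of v without neighbours before v would have v as its leftmost neighbour.
-- Conversely, let C be a dominating clique of N(v).  By Dirac's argument, for every clique
-- K not containing all of a vertex set S, G[S] has a simplicial vertex outside K; so some
-- perfect elimination ordering starts with C.  In it every neighbour of v is σ(1), or is
-- adjacent to σ(1) ∈ C, or has a neighbour in C; as C precedes v, v is not the leftmost
-- neighbour of any vertex but σ(1).
module Submission where

open import Defs
open import Data.Bool.Base using (T)
open import Data.Bool.Properties using (T-irrelevant)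
open import Data.Empty using (⊥-elim)
open import Data.Fin.Base using (Fin; zero; suc; toℕ; opposite; _<_)
open import Data.Fin.Induction using (<-wellFounded)
open import Data.Fin.Permutation using (↔⇒≡)
open import Data.Fin.Properties
  using (_<?_; <-cmp; inj⇒≟; opposite-prop; opposite-involutive; toℕ-injective; toℕ<n)
  renaming (any? to anyFin?)
open import Data.List.Base using (List; []; _∷_; filter; length; lookup; tabulate)
open import Data.List.Membership.Propositional using (_∈_; _∉_; find; lose)
open import Data.List.Membership.Propositional.Properties
  using (∈-filter⁺; ∈-filter⁻; ∈-lookup; ∈-tabulate⁺)
open import Data.List.Properties using (filter-notAll)
open import Data.List.Relation.Unary.All as All using (All; []; _∷_)
open import Data.List.Relation.Unary.All.Properties using (¬Any⇒All¬)
open import Data.List.Relation.Unary.Any as Any using (Any; here; there; any?; index)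
open import Data.List.Relation.Unary.Any.Properties using (lookup-index)
open import Data.Nat.Base as ℕ using (ℕ; suc; _≤_; _+_; s≤s; z≤n)
open import Data.Nat.Induction using () renaming (<-wellFounded to ℕ-<-wellFounded)
open import Data.Nat.Properties as ℕ using (suc-injective)
open import Data.Product using (Σ; ∃-syntax; _×_; _,_; proj₁; proj₂)
open import Data.Sum.Base using (_⊎_; inj₁; inj₂)
open import Function.Base using (_∘_; id)
open import Function.Bundles using (_↔_; _⇔_; Injection; Inverse; mk⇔; mk↔ₛ′)
open import Function.Definitions using (Injective)
open import Function.Properties.Inverse using (↔-sym; ↔-trans; ↔⇒↣)
open import Induction.WellFounded using (Acc; acc)
open import Level using (0ℓ)
open import Relation.Binary.Construct.Closure.ReflexiveTransitive using (Star; ε; _◅_; _◅◅_)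
open import Relation.Binary.Construct.Closure.Symmetric using (SymClosure; fwd; bwd)
open import Relation.Binary.Core using (Rel)
open import Relation.Binary.Definitions
  using (DecidableEquality; tri<; tri≈; tri>) renaming (Decidable to Decidable₂)
open import Relation.Binary.PropositionalEquality
  using (_≡_; _≢_; refl; sym; trans; cong; subst; subst₂)
open import Relation.Nullary using (¬_; Dec; yes; no)
open import Relation.Nullary.Decidable
  using (_⊎-dec_; _×-dec_; ¬?; T?; map′; ⌊_⌋; toWitness; fromWitness; decidable-stable)
open import Relation.Unary using (Pred; Decidable)

-- Lists without repetitions, reversed positions and finite closures.

lookup-injective-∷ : {A : Set} {x : A} {xs : List A} → x ∉ xs →
                     Injective _≡_ _≡_ (lookup xs) → Injective _≡_ _≡_ (lookup (x ∷ xs))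
lookup-injective-∷ x∉ inj {zero}  {zero}  _    = refl
lookup-injective-∷ x∉ inj {zero}  {suc j} refl = ⊥-elim (x∉ (∈-lookup j))
lookup-injective-∷ x∉ inj {suc i} {zero}  refl = ⊥-elim (x∉ (∈-lookup i))
lookup-injective-∷ x∉ inj {suc i} {suc j} eq   = cong suc (inj eq)

opposite-< : ∀ {n} {i j : Fin n} → i < j → opposite j < opposite i
opposite-< {n} {i} {j} i<j =
  subst₂ ℕ._<_ (sym (opposite-prop j)) (sym (opposite-prop i)) (ℕ.∸-monoʳ-< (s≤s i<j) (toℕ<n j))

opposite-<⁻ : ∀ {n} {i j : Fin n} → opposite i < opposite j → j < i
opposite-<⁻ lt = subst₂ _<_ (opposite-involutive _) (opposite-involutive _) (opposite-< lt)

-- Two walks with different ends cannot both be empty, and a nonempty one has a first step.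
outgoing : {A : Set} {R : Rel A 0ℓ} {a b c : A} → Star R a b → Star R a c → b ≢ c → ∃[ d ] R a d
outgoing (r ◅ _) _       _   = _ , r
outgoing ε       (r ◅ _) _   = _ , r
outgoing ε       ε       b≢c = ⊥-elim (b≢c refl)

module Removal {A : Set} (_≟_ : DecidableEquality A) where
  _∖_ : List A → A → List A
  xs ∖ x = filter (λ y → ¬? (x ≟ y)) xs

  ∈-∖⁺ : ∀ {xs x y} → y ∈ xs → x ≢ y → y ∈ xs ∖ x
  ∈-∖⁺ {x = x} = ∈-filter⁺ (λ y → ¬? (x ≟ y))

  ∈-∖⁻ : ∀ xs {x y} → y ∈ xs ∖ x → y ∈ xs × x ≢ y
  ∈-∖⁻ xs {x} = ∈-filter⁻ (λ y → ¬? (x ≟ y)) {xs = xs}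

  length-∖ : ∀ {xs x} → x ∈ xs → length (xs ∖ x) ℕ.< length xs
  length-∖ {xs} {x} x∈ = filter-notAll (λ y → ¬? (x ≟ y)) xs (lose x∈ (λ x≢x → x≢x refl))

  -- Each round moves one element from `W` to `B`, so `length W` decreases; `P` is an invariant of
  -- the elements collected.
  closure : {P : Pred A 0ℓ} {R : Rel A 0ℓ} → Decidable₂ R → ∀ W → Acc ℕ._<_ (length W) →
            (∀ {b w} → P b → w ∈ W → R b w → P w) → ∀ B → All P B →
            ∃[ B′ ] ((∀ {b} → b ∈ B → b ∈ B′) × All P B′ ×
                     (∀ {b w} → b ∈ B′ → w ∈ W → R b w → w ∈ B′))
  closure R? W (acc rs) P-step B PB with any? (λ w → any? (λ b → R? b w) B) W
  ... | no none = B , id , PB , λ b∈ w∈ r → ⊥-elim (none (lose w∈ (lose b∈ r)))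
  ... | yes some with find some
  ...   | w , w∈ , hit with find hit
  ...     | b , b∈ , r
            with closure R? (W ∖ w) (rs (length-∖ w∈)) (λ Pc → P-step Pc ∘ proj₁ ∘ ∈-∖⁻ W)
                   (w ∷ B) (P-step (All.lookup PB b∈) w∈ r ∷ PB)
  ...       | B′ , B⊆ , PB′ , closed = B′ , B⊆ ∘ there , PB′ , closed′
    where
    closed′ : ∀ {c y} → c ∈ B′ → y ∈ W → _ → y ∈ B′
    closed′ {y = y} c∈ y∈ r′ with w ≟ y
    ... | yes refl = B⊆ (here refl)
    ... | no w≢y = closed c∈ (∈-∖⁺ y∈ w≢y) r′

module FiniteGraph {V : Set} (_≟_ : DecidableEquality V) (G : Graph V) where
  open Graph G using (Adj; symm; irrefl)
  open Removal _≟_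

  Adj? : ∀ x y → Dec (Adj x y)
  Adj? x y = T? (Graph.adj G x y)

  -- Induced paths and the cycles they close up to.

  Consecutive : ∀ {k} → Fin k → Fin k → Set
  Consecutive i j = suc (toℕ i) ≡ toℕ j

  -- An induced path listed without its last vertex t.
  data PathTo (t : V) : List V → Set where
    [_]  : ∀ {a} → Adj a t → PathTo t (a ∷ [])
    step : ∀ {a b l} → Adj a b → ¬ Adj a t → a ∉ b ∷ l → All (¬_ ∘ Adj a) l →
           PathTo t (b ∷ l) → PathTo t (a ∷ b ∷ l)

  path-injective : ∀ {t p} → PathTo t p → Injective _≡_ _≡_ (lookup p)
  path-injective [ _ ] {zero} {zero} _ = refl
  path-injective (step _ _ a∉ _ π) = lookup-injective-∷ a∉ (path-injective π)

  path-adj⁺ : ∀ {t p} → PathTo t p → ∀ i j → Consecutive i j → Adj (lookup p i) (lookup p j)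
  path-adj⁺ [ _ ] zero zero ()
  path-adj⁺ (step ab _ _ _ _) zero (suc zero) _ = ab
  path-adj⁺ (step _ _ _ _ π) (suc i) (suc j) eq = path-adj⁺ π i j (suc-injective eq)

  path-adj⁻ : ∀ {t p} → PathTo t p → ∀ i j → Adj (lookup p i) (lookup p j) →
              Consecutive i j ⊎ Consecutive j i
  path-adj⁻ {p = _ ∷ _} _ zero zero e = ⊥-elim (irrefl e)
  path-adj⁻ (step _ _ _ _ _) zero (suc zero) _ = inj₁ refl
  path-adj⁻ (step _ _ _ a≁ _) zero (suc (suc j)) e = ⊥-elim (All.lookup a≁ (∈-lookup j) e)
  path-adj⁻ (step _ _ _ _ _) (suc zero) zero _ = inj₂ refl
  path-adj⁻ (step _ _ _ a≁ _) (suc (suc i)) zero e = ⊥-elim (All.lookup a≁ (∈-lookup i) (symm e))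
  path-adj⁻ (step _ _ _ _ π) (suc i) (suc j) e with path-adj⁻ π i j e
  ... | inj₁ eq = inj₁ (cong suc eq)
  ... | inj₂ eq = inj₂ (cong suc eq)

  path-end⁺ : ∀ {t p} → PathTo t p → ∀ i → suc (toℕ i) ≡ length p → Adj (lookup p i) t
  path-end⁺ [ at ] zero _ = at
  path-end⁺ (step _ _ _ _ π) (suc i) eq = path-end⁺ π i (suc-injective eq)

  path-end⁻ : ∀ {t p} → PathTo t p → ∀ i → Adj (lookup p i) t → suc (toℕ i) ≡ length p
  path-end⁻ [ _ ] zero _ = refl
  path-end⁻ (step _ ≁t _ _ _) zero e = ⊥-elim (≁t e)
  path-end⁻ (step _ _ _ _ π) (suc i) e = cong suc (path-end⁻ π i e)

  -- The cycle is t, x, s followed by the remaining vertices of the path.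
  close-cycle : ∀ {t x s p} → PathTo t (s ∷ p) → Adj x t → Adj x s →
                All (λ y → ¬ Adj x y) p → x ∉ s ∷ p → t ∉ s ∷ p →
                InducedCycle G (2 + length (s ∷ p))
  close-cycle {t} {x} {s} {p} π xt xs x≁ x∉ t∉ = record
    { vertex    = vtx
    ; injective = inj
    ; adjacency = λ i j → mk⇔ (adj⁻ i j) λ
        { (fwd c) → adj⁺ i j c
        ; (bwd c) → symm (adj⁺ j i c) }
    }
    where
    vtx = lookup (t ∷ x ∷ s ∷ p)

    inj : Injective _≡_ _≡_ vtx
    inj = lookup-injective-∷
      (λ { (here refl) → irrefl xt ; (there t∈) → t∉ t∈ })
      (lookup-injective-∷ x∉ (path-injective π))

    adj⁺ : ∀ i j → CyclicSuc i j → Adj (vtx i) (vtx j)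
    adj⁺ zero (suc zero) (inj₁ _) = symm xt
    adj⁺ (suc zero) (suc (suc zero)) (inj₁ _) = xs
    adj⁺ (suc (suc i)) (suc (suc j)) (inj₁ eq) =
      path-adj⁺ π i j (suc-injective (suc-injective eq))
    adj⁺ (suc (suc i)) zero (inj₂ (eq , _)) =
      path-end⁺ π i (suc-injective (suc-injective eq))

    adj⁻ : ∀ i j → Adj (vtx i) (vtx j) → SymClosure CyclicSuc i j
    adj⁻ zero zero e = ⊥-elim (irrefl e)
    adj⁻ zero (suc zero) _ = fwd (inj₁ refl)
    adj⁻ zero (suc (suc j)) e =
      bwd (inj₂ (cong (λ n → suc (suc n)) (path-end⁻ π j (symm e)) , refl))
    adj⁻ (suc zero) zero _ = bwd (inj₁ refl)
    adj⁻ (suc zero) (suc zero) e = ⊥-elim (irrefl e)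
    adj⁻ (suc zero) (suc (suc zero)) _ = fwd (inj₁ refl)
    adj⁻ (suc zero) (suc (suc (suc j))) e = ⊥-elim (All.lookup x≁ (∈-lookup j) e)
    adj⁻ (suc (suc i)) zero e =
      fwd (inj₂ (cong (λ n → suc (suc n)) (path-end⁻ π i e) , refl))
    adj⁻ (suc (suc zero)) (suc zero) _ = bwd (inj₁ refl)
    adj⁻ (suc (suc (suc i))) (suc zero) e = ⊥-elim (All.lookup x≁ (∈-lookup i) (symm e))
    adj⁻ (suc (suc i)) (suc (suc j)) e with path-adj⁻ π i j e
    ... | inj₁ eq = fwd (inj₁ (cong (λ n → suc (suc n)) eq))
    ... | inj₂ eq = bwd (inj₁ (cong (λ n → suc (suc n)) eq))

  module _ {Q : Pred V 0ℓ} where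
    -- The new path jumps from a to the last vertex of the old one that equals
    -- or is adjacent to a.
    attach : ∀ {t a b p} → ¬ Adj a t → PathTo t (b ∷ p) → All Q (b ∷ p) →
             Any (λ y → a ≡ y ⊎ Adj a y) (b ∷ p) →
             ∃[ p′ ] (PathTo t (a ∷ p′) × All Q p′)
    attach {t} {a} {b} {p} a≁t π q near with any? (λ y → (a ≟ y) ⊎-dec Adj? a y) p
    attach a≁t (step _ _ _ _ π) (_ ∷ q) _ | yes near = attach a≁t π q near
    attach _ π (_ ∷ q) (here (inj₁ refl)) | no _ = _ , π , q
    attach a≁t π q (here (inj₂ ab)) | no far = _ , step ab a≁t
      (λ { (here refl) → irrefl ab ; (there a∈) → far (Any.map inj₁ a∈) })
      (All.map (_∘ inj₂) (¬Any⇒All¬ _ far)) π , q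
    attach _ _ _ (there near) | no far = ⊥-elim (far near)

    extend : ∀ {t a b p} → Adj a b → PathTo t (b ∷ p) → All Q (b ∷ p) →
             ∃[ p′ ] (PathTo t (a ∷ p′) × All Q p′)
    extend {t} {a} ab π q with Adj? a t
    ... | yes at = [] , [ at ] , []
    ... | no a≁t = attach a≁t π q (here (inj₂ ab))

    -- The path is built from the far end, with shortcuts taken at each step. `Q` constrains only
    -- its interior: in the application the ends `a` and `t` are neighbours of `x`, while the
    -- vertices between them are not.
    walk⇒path : ∀ {a b t} → Star (λ y z → Adj y z × Q z) a b → Adj b t →
                ∃[ p ] (PathTo t (a ∷ p) × All Q p)
    walk⇒path ε bt = [] , [ bt ] , []
    walk⇒path ((ac , qc) ◅ w) bt with walk⇒path w bt
    ... | p , π , q = extend ac π (qc ∷ q)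

  -- Separators in a chordal graph.

  NonNeighbor : V → Pred V 0ℓ
  NonNeighbor x u = x ≢ u × ¬ Adj x u

  nonNeighbor? : ∀ x → Decidable (NonNeighbor x)
  nonNeighbor? x u = ¬? (x ≟ u) ×-dec ¬? (Adj? x u)

  -- When `B` is a component of the non-neighbours of `x` in `S`, these vertices separate `B` from
  -- `x` within `S`.
  Boundary : V → List V → Pred V 0ℓ
  Boundary x B u = Adj x u × Any (Adj u) B

  boundary? : ∀ x B → Decidable (Boundary x B)
  boundary? x B u = Adj? x u ×-dec any? (Adj? u) B

  module _ (chordal : Chordal G) where
    -- The walk shortens to an induced path from `s` to `t`. If this is more than a single edge, it
    -- forms with `x` an induced cycle on at least the four vertices `t`, `x`, `s`, `c`.
    separator-clique : ∀ {x s t b} → Adj x s → Adj x t → s ≢ t →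
                       Star (λ y z → Adj y z × NonNeighbor x z) s b → Adj b t → Adj s t
    separator-clique {x} {s} {t} xs xt s≢t w bt with walk⇒path w bt
    ... | [] , [ st ] , _ = st
    ... | c ∷ p , π , q = ⊥-elim (chordal _ (s≤s (s≤s (s≤s (s≤s z≤n))))
      (close-cycle π xt xs (All.map proj₂ q)
        (λ { (here refl) → irrefl xs ; (there x∈) → proj₁ (All.lookup q x∈) refl })
        (λ { (here refl) → s≢t refl ; (there t∈) → proj₂ (All.lookup q t∈) xt })))

    -- B is the component of z in S ∖ N[x].  A shortest path through B between two
    -- nonadjacent boundary vertices would close up through x to an induced cycle.
    component : ∀ {x} S {z} → NonNeighbor x z →
                ∃[ B ] (z ∈ B × (∀ {b} → b ∈ B → NonNeighbor x b) × IsClique G (Boundary x B) ×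
                        (∀ {b u} → b ∈ B → u ∈ S → Adj b u → u ∈ B ⊎ Boundary x B u))
    component {x} S {z} Qz = B , ⊆B (here refl) , proj₁ ∘ All.lookup B-connected , boundary-clique , absorb
      where
      Walk : Rel V 0ℓ
      Walk = Star (λ u w → Adj u w × NonNeighbor x w)

      -- Walks in both directions are stored because a step of `Walk` constrains only its target, so
      -- reversing a walk is not immediate.
      ConnectedToRoot : Pred V 0ℓ
      ConnectedToRoot u = NonNeighbor x u × Walk z u × Walk u z

      W : List V
      W = filter (nonNeighbor? x) S

      grow : ∀ {u w} → ConnectedToRoot u → w ∈ W → Adj u w → ConnectedToRoot w
      grow (Qu , zu , uz) w∈ uw =
        let _ , Qw = ∈-filter⁻ (nonNeighbor? x) {xs = S} w∈
        in Qw , zu ◅◅ ((uw , Qw) ◅ ε) , (symm uw , Qu) ◅ uz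

      closed = closure Adj? W (ℕ-<-wellFounded _) grow (z ∷ []) ((Qz , ε , ε) ∷ [])

      B : List V
      B = proj₁ closed

      ⊆B : ∀ {u} → u ∈ z ∷ [] → u ∈ B
      ⊆B = proj₁ (proj₂ closed)

      B-connected : All ConnectedToRoot B
      B-connected = proj₁ (proj₂ (proj₂ closed))

      boundary-clique : IsClique G (Boundary x B)
      boundary-clique (xs , s~B) (xt , t~B) s≢t with find s~B | find t~B
      ... | c , c∈ , sc | d , d∈ , td =
        let Qc , _ , cz = All.lookup B-connected c∈
            _ , zd , _ = All.lookup B-connected d∈
        in separator-clique xs xt s≢t ((sc , Qc) ◅ cz ◅◅ zd) (symm td)

      absorb : ∀ {b u} → b ∈ B → u ∈ S → Adj b u → u ∈ B ⊎ Boundary x B u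
      absorb {b} {u} b∈ u∈ bu with Adj? x u
      ... | yes xu = inj₂ (xu , lose b∈ (symm bu))
      -- Here `u` differs from `x` because `b` is not adjacent to `x`; so `u` is in `W`, and
      -- closedness puts it in `B`.
      ... | no x≁u = inj₁ (proj₂ (proj₂ (proj₂ closed)) b∈
              (∈-filter⁺ (nonNeighbor? x) u∈
                ((λ { refl → proj₂ (proj₁ (All.lookup B-connected b∈)) (symm bu) }) , x≁u))
              bu)

    -- Simplicial vertices outside a clique.

    Simplicial : List V → V → Set
    Simplicial S b = IsClique G (λ y → y ∈ S × Adj b y)

    -- The induction is on |S|.  Take x ∈ K ∩ S (or any x ∈ S, if K misses S).  If x
    -- is adjacent to the rest of S, drop it.  Otherwise replace S by a component B of
    -- S ∖ N[x] together with its boundary, and K by the boundary, a clique: a vertex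
    -- of B simplicial there is so in S and is not in K, being nonadjacent to x.
    simplicial-outside : ∀ S → Acc ℕ._<_ (length S) →
                         {K : Pred V 0ℓ} → Decidable K → IsClique G K →
                         ∀ {y} → y ∈ S → ¬ K y → ∃[ b ] (b ∈ S × ¬ K b × Simplicial S b)

    -- The mutual recursion terminates because `S` shrinks here: either `x` itself is dropped, or
    -- the list is cut down to `B` and its boundary, neither of which contains `x`.
    simplicial-outside-meeting : ∀ S → Acc ℕ._<_ (length S) →
                         {K : Pred V 0ℓ} → Decidable K → IsClique G K →
                         ∀ {x y} → x ∈ S → K x → y ∈ S → ¬ K y →
                         ∃[ b ] (b ∈ S × ¬ K b × Simplicial S b)

    simplicial-outside S ac K? K-clique {y} y∈ ¬Ky with any? K? S
    ... | yes K∩S with find K∩S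
    ...   | x , x∈ , Kx = simplicial-outside-meeting S ac K? K-clique x∈ Kx y∈ ¬Ky
    simplicial-outside S ac K? K-clique {y} y∈ ¬Ky | no K∩S=∅ with any? (λ z → ¬? (z ≟ y)) S
    ... | no only-y = y , y∈ , ¬Ky , λ { {u} (u∈ , yu) _ _ →
            ⊥-elim (only-y (lose u∈ (λ { refl → irrefl yu }))) }
    ... | yes other with find other
    ...   | z , z∈ , z≢y
            with simplicial-outside-meeting S ac (_≟ y)
                   (λ { refl refl y≢y → ⊥-elim (y≢y refl) }) y∈ refl z∈ z≢y
    ...     | b , b∈ , _ , simp = b , b∈ , (λ Kb → K∩S=∅ (lose b∈ Kb)) , simp

    simplicial-outside-meeting S (acc rs) {K} K? K-clique {x} {y} x∈ Kx y∈ ¬Ky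
      with any? (nonNeighbor? x) S
    ... | no universal
          with simplicial-outside (S ∖ x) (rs (length-∖ x∈)) K? K-clique
                 (∈-∖⁺ y∈ (λ { refl → ¬Ky Kx })) ¬Ky
    ...   | b , b∈ , ¬Kb , simp = b , proj₁ (∈-∖⁻ S b∈) , ¬Kb , simp′
      where
      x-adj : ∀ {z} → z ∈ S → x ≢ z → Adj x z
      x-adj {z} z∈ x≢z = decidable-stable (Adj? x z) (λ x≁z → universal (lose z∈ (x≢z , x≁z)))

      simp′ : Simplicial S b
      simp′ {u} {w} (u∈ , bu) (w∈ , bw) u≢w with x ≟ u | x ≟ w
      ... | yes refl | _ = x-adj w∈ u≢w
      ... | no x≢u | yes refl = symm (x-adj u∈ x≢u)
      ... | no x≢u | no x≢w = simp (∈-∖⁺ u∈ x≢u , bu) (∈-∖⁺ w∈ x≢w , bw) u≢w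
    simplicial-outside-meeting S (acc rs) {K} K? K-clique {x} {y} x∈ Kx y∈ ¬Ky
        | yes far with find far
    ... | z , z∈ , Qz with component S Qz
    ...   | B , z∈B , B-far , boundary-clique , absorb
            with simplicial-outside (filter near? S) (rs (filter-notAll near? S (lose x∈ x-absent)))
                   (boundary? x B) boundary-clique
                   (∈-filter⁺ near? z∈ (inj₁ z∈B)) (proj₂ Qz ∘ proj₁)
      where
      near? : Decidable (λ u → u ∈ B ⊎ Boundary x B u)
      near? u = any? (u ≟_) B ⊎-dec boundary? x B u

      x-absent : ¬ (x ∈ B ⊎ Boundary x B x)
      x-absent (inj₁ x∈B) = proj₁ (B-far x∈B) refl
      x-absent (inj₂ (xx , _)) = irrefl xx
    ...     | b , b∈near , ¬boundary , simp with ∈-filter⁻ _ {xs = S} b∈near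
    ...       | _  , inj₂ boundary = ⊥-elim (¬boundary boundary)
    ...       | b∈ , inj₁ b∈B =
      b , b∈ , (λ Kb → proj₂ (B-far b∈B) (K-clique Kx Kb (proj₁ (B-far b∈B)))) ,
      -- By `absorb`, all neighbours of `b` in `S` survive in the smaller list, so simpliciality
      -- carries over.
      λ (u∈ , bu) (w∈ , bw) →
        simp (∈-filter⁺ _ u∈ (absorb b∈B u∈ bu) , bu) (∈-filter⁺ _ w∈ (absorb b∈B w∈ bw) , bw)

    -- Perfect elimination orderings that start with a given clique.

    -- The list runs from the last vertex of the ordering to the first.
    data Elimination (K : Pred V 0ℓ) : List V → Set where
      []  : Elimination K []
      add : ∀ {b l} → b ∉ l → Simplicial l b → (K b → All K l) →
            Elimination K l → Elimination K (b ∷ l)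

    elimination-injective : ∀ {K l} → Elimination K l → Injective _≡_ _≡_ (lookup l)
    elimination-injective [] {()}
    elimination-injective (add b∉ _ _ e) = lookup-injective-∷ b∉ (elimination-injective e)

    -- Entries listed after `v` lie in the tail in which `v` was simplicial when it was added.
    elimination-clique : ∀ {K l} → Elimination K l → ∀ {v y z} →
                         (v∈ : v ∈ l) (y∈ : y ∈ l) (z∈ : z ∈ l) →
                         index v∈ < index y∈ → index v∈ < index z∈ →
                         Adj v y → Adj v z → y ≢ z → Adj y z
    elimination-clique (add _ simp _ _) (here refl) (there y∈) (there z∈) _ _ vy vz =
      simp (y∈ , vy) (z∈ , vz)
    elimination-clique (add _ _ _ e) (there v∈) (there y∈) (there z∈) (s≤s v<y) (s≤s v<z) =
      elimination-clique e v∈ y∈ z∈ v<y v<z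

    -- By the third argument of `add`, a member of `K` is listed only when nothing outside `K`
    -- remains.
    elimination-last : ∀ {K l} → Elimination K l → ∀ {u w} (u∈ : u ∈ l) (w∈ : w ∈ l) →
                       ¬ K u → K w → index u∈ < index w∈
    elimination-last _ (here refl) (here refl) ¬Ku Kw = ⊥-elim (¬Ku Kw)
    elimination-last _ (here refl) (there _) _ _ = s≤s z≤n
    elimination-last (add _ _ K-last _) (there u∈) (here refl) ¬Ku Kw =
      ⊥-elim (¬Ku (All.lookup (K-last Kw) u∈))
    elimination-last (add _ _ _ e) (there u∈) (there w∈) ¬Ku Kw = s≤s (elimination-last e u∈ w∈ ¬Ku Kw)

    module _ {K : Pred V 0ℓ} (K? : Decidable K) (K-clique : IsClique G K) where
      -- As long as a vertex outside `K` remains, one that is simplicial can be chosen. After that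
      -- `S` is part of the clique `K`, so any vertex of it will do.
      next : ∀ {x} S → x ∈ S → ∃[ b ] (b ∈ S × (K b → All K S) × Simplicial S b)
      next {x} S x∈ with any? (¬? ∘ K?) S
      ... | yes some =
        let y , y∈ , ¬Ky = find some
            b , b∈ , ¬Kb , simp = simplicial-outside S (ℕ-<-wellFounded _) K? K-clique y∈ ¬Ky
        in b , b∈ , ⊥-elim ∘ ¬Kb , simp
      ... | no none = x , x∈ , (λ _ → All.tabulate S⊆K) ,
                      λ (u∈ , _) (w∈ , _) → K-clique (S⊆K u∈) (S⊆K w∈)
        where
        S⊆K : ∀ {u} → u ∈ S → K u
        S⊆K {u} u∈ = decidable-stable (K? u) (none ∘ lose u∈)

      eliminate : ∀ S → Acc ℕ._<_ (length S) →
                  ∃[ l ] (Elimination K l × (∀ {u} → u ∈ S → u ∈ l) × (∀ {u} → u ∈ l → u ∈ S))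
      eliminate [] _ = [] , [] , id , id
      eliminate S@(_ ∷ _) (acc rs) with next S (here refl)
      ... | b , b∈ , K-last , simp
            with eliminate (S ∖ b) (rs (length-∖ b∈))
      ...   | l , e , ⊆l , l⊆ = b ∷ l
            , add (λ b∈l → proj₂ (∈-∖⁻ S (l⊆ b∈l)) refl)
                  (λ (u∈ , bu) (w∈ , bw) → simp (l⊆S u∈ , bu) (l⊆S w∈ , bw))
                  (λ Kb → All.tabulate (All.lookup (K-last Kb) ∘ l⊆S))
                  e
            , S⊆
            , λ { (here refl) → b∈ ; (there u∈) → l⊆S u∈ }
        where
        l⊆S : ∀ {u} → u ∈ l → u ∈ S
        l⊆S = proj₁ ∘ ∈-∖⁻ S ∘ l⊆

        S⊆ : ∀ {u} → u ∈ S → u ∈ b ∷ l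
        S⊆ {u} u∈ with b ≟ u
        ... | yes refl = here refl
        ... | no b≢u = there (⊆l (∈-∖⁺ u∈ b≢u))

      clique-first-PEO : ∀ {n} → Fin n ↔ V →
                         ∃[ σ ] (IsPEO G {n} σ × (∀ {w u} → K w → ¬ K u → Precedes σ w u))
      clique-first-PEO {n} ι with eliminate (tabulate (Inverse.to ι)) (ℕ-<-wellFounded _)
      -- The positions of `τ` range over `length l`, which equals `n` only because both index `V`
      -- bijectively; the ordering is transported together with its properties.
      ... | l , e , V⊆l , _ = subst
              (λ m → Σ (Ordering V m) λ σ → IsPEO G σ × (∀ {w u} → K w → ¬ K u → Precedes σ w u))
              (↔⇒≡ (↔-trans τ (↔-sym ι)))
              ( τ
              , (λ v (vy , y<v) (vz , z<v) → elimination-clique e (all v) (all _) (all _)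
                   (opposite-<⁻ y<v) (opposite-<⁻ z<v) vy vz)
              , λ Kw ¬Ku → opposite-< (elimination-last e (all _) (all _) ¬Ku Kw))
        where
        all : ∀ y → y ∈ l
        all y = V⊆l (subst (_∈ tabulate (Inverse.to ι)) (Inverse.strictlyInverseˡ ι y)
                      (∈-tabulate⁺ (Inverse.from ι y)))

        τ : Ordering V (length l)
        τ = mk↔ₛ′ (lookup l ∘ opposite) (opposite ∘ index ∘ all)
          (λ y → trans (cong (lookup l) (opposite-involutive _)) (sym (lookup-index (all y))))
          (λ i → trans (cong opposite (elimination-injective e (sym (lookup-index (all _)))))
                       (opposite-involutive i))

-- Leftmost neighbours and leaves of the F-tree.

module OrderedGraph {V : Set} {n : ℕ} (G : Graph V) (σ : Ordering V n) where
  open Graph G using (Adj; symm; irrefl)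
  open Inverse σ using (to; from; strictlyInverseˡ)

  position-injective : ∀ {x y} → from x ≡ from y → x ≡ y
  position-injective eq = trans (sym (strictlyInverseˡ _)) (trans (cong to eq) (strictlyInverseˡ _))

  first-minimal : ∀ {f x} → IsFirst σ f → ¬ Precedes σ x f
  first-minimal {x = x} f-first x<f with subst (λ i → toℕ (from x) ℕ.< i) f-first x<f
  ... | ()

  first-least : ∀ {f x} → IsFirst σ f → ¬ Precedes σ f x → f ≡ x
  first-least {x = x} f-first f≮x = position-injective (toℕ-injective (trans f-first
    (sym (ℕ.n≤0⇒n≡0 (subst (λ i → toℕ (from x) ℕ.≤ i) f-first (ℕ.≮⇒≥ f≮x))))))

  earlier-neighbor? : ∀ v u → Dec (∃[ w ] (Adj v w × Precedes σ w u))
  earlier-neighbor? v u = map′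
    (λ (i , vi , i<) → to i , vi , i<)
    (λ (w , vw , w<) → from w , subst (Adj v) (sym (strictlyInverseˡ w)) vw
                     , subst (λ y → Precedes σ y u) (sym (strictlyInverseˡ w)) w<)
    (anyFin? (λ i → T? (Graph.adj G v (to i)) ×-dec (from (to i) <? from u)))

  -- Passing to ever earlier neighbours must stop. The second conclusion later places `p` before `v`
  -- when `u` is a left neighbour.
  leftmost-neighbor : ∀ v u → Adj v u → Acc _<_ (from u) →
                      ∃[ p ] (IsLeftmostNeighbor G σ v p × ¬ Precedes σ u p)
  leftmost-neighbor v u vu (acc rs) with earlier-neighbor? v u
  ... | no none = u , (vu , λ w vw w<u → none (w , vw , w<u)) , ℕ.<-irrefl refl
  ... | yes (w , vw , w<u) =
    let p , p-left , w≮p = leftmost-neighbor v w vw (rs w<u)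
    in p , p-left , λ u<p → w≮p (ℕ.<-trans w<u u<p)

  Down : Rel V 0ℓ
  Down x y = Adj x y × Precedes σ y x

  module _ (peo : IsPEO G σ) {f : V} (f-first : IsFirst σ f) where
    -- At a peak z ← y → x the neighbours z and x of y are adjacent or equal,
    -- so the peak can be cut off.
    climb : ∀ {y x} → Star Down y f → Down x y ⊎ Down y x → Star Down x f
    climb d (inj₁ xy) = xy ◅ d
    climb ε (inj₂ (_ , x<f)) = ⊥-elim (first-minimal f-first x<f)
    climb {y} {x} (_◅_ {j = z} yz d) (inj₂ yx) with <-cmp (from x) (from z)
    ... | tri< x<z x≢z _ = climb d (inj₂ (peo y yz yx (λ { refl → x≢z refl }) , x<z))
    ... | tri≈ _ x≡z _ = subst (λ u → Star Down u f) (sym (position-injective x≡z)) d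
    ... | tri> _ x≢z z<x = (peo y yx yz (λ { refl → x≢z refl }) , z<x) ◅ d

    -- The walk is treated from its far end: `climb` joins each edge, rising or falling, to the
    -- descending walk already obtained.
    descend : ∀ {x} → Star Adj x f → Star Down x f
    descend ε = ε
    descend {x} (_◅_ {j = y} xy w) with <-cmp (from x) (from y)
    ... | tri< x<y _ _ = climb (descend w) (inj₂ (symm xy , x<y))
    ... | tri≈ _ x≡y _ = ⊥-elim (irrefl (subst (Adj x) (sym (position-injective x≡y)) xy))
    ... | tri> _ _ y<x = climb (descend w) (inj₁ (xy , y<x))

    -- A descending walk from `v` to `f` is nonempty, and its first edge leads to the left.
    left-neighbor : Connected G → ∀ {v} → ¬ IsFirst σ v → ∃[ u ] Down v u
    left-neighbor conn {v} v-not-first with descend (conn v f)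
    ... | ε = ⊥-elim (v-not-first f-first)
    ... | vu ◅ _ = _ , vu

    leaf⇒dominating-clique : Connected G → ∀ {v} → IsFBranchLeaf G σ v →
                             HasDominatingClique (induced G (N G v))
    leaf⇒dominating-clique conn {v} (v-not-first , q , _ , unique) =
        (λ (w , _) → ⌊ from w <? from v ⌋)
      , (λ { {_ , vx} {_ , vy} Cx Cy x≢y → peo v (vx , toWitness Cx) (vy , toWitness Cy)
               λ { refl → x≢y (cong (_ ,_) (T-irrelevant vx vy)) } })
      , dominating
      where
      u = proj₁ (left-neighbor conn v-not-first)
      vu = proj₁ (proj₂ (left-neighbor conn v-not-first))
      u<v = proj₂ (proj₂ (left-neighbor conn v-not-first))

      dominating : IsDominating (induced G (N G v)) (λ (w , _) → T ⌊ from w <? from v ⌋)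
      dominating (w , vw) with from w <? from v
      ... | yes _ = inj₁ _
      ... | no w≮v with earlier-neighbor? w v
      -- Both `v` and `y` are left neighbours of `w`, hence adjacent; so `y` is in the clique and
      -- dominates `w`.
      ...   | yes (y , wy , y<v) =
              inj₂ ((y , peo w (symm vw , v<w) (wy , ℕ.<-trans y<v v<w) λ { refl → ℕ.<-irrefl refl y<v })
                   , fromWitness y<v , wy)
        where
        v<w : Precedes σ v w
        v<w = ℕ.≤∧≢⇒< (ℕ.≮⇒≥ w≮v) (λ eq → irrefl (subst (Adj v) (sym (position-injective (toℕ-injective eq))) vw))
      -- Now `v` is the leftmost neighbour of `w`, so `v` has tree edges to `w` and to its own
      -- leftmost neighbour `p`. Uniqueness gives `w ≡ p`, but `p` is no later than `u` and so
      -- precedes `v`.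
      ...   | no none =
        let p , p-left , u≮p = leftmost-neighbor v u vu (<-wellFounded _)
            w≡p = trans (sym (unique (bwd (w-not-first , symm vw , λ y wy y<v → none (y , wy , y<v)))))
                        (unique (fwd (v-not-first , p-left)))
        in ⊥-elim (w≮v (ℕ.≤-<-trans (ℕ.≮⇒≥ (subst (λ y → ¬ Precedes σ u y) (sym w≡p) u≮p)) u<v))
        where
        w-not-first : ¬ IsFirst σ w
        w-not-first w-first = w≮v (subst (ℕ._< toℕ (from v)) (sym w-first) (ℕ.n≢0⇒n>0 v-not-first))

  -- Being first, `f` is the leftmost neighbour of `v`. Any other neighbour `u` has a neighbour in
  -- `K`, namely `f` if `u` is itself in `K`, and this neighbour precedes `v`.
  dominating-clique-first⇒leaf : {K : Pred V 0ℓ} → IsClique G K → ∀ {f v} → IsFirst σ f → K f →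
    (∀ {w} → K w → Adj v w × Precedes σ w v) →
    (∀ {u} → Adj v u → K u ⊎ ∃[ w ] (K w × Adj u w)) →
    IsFBranchLeaf G σ v
  dominating-clique-first⇒leaf {K} K-clique {f} {v} f-first Kf K-left dominating =
      v-not-first
    , f
    , fwd (v-not-first , proj₁ (K-left Kf) , λ _ _ → first-minimal f-first)
    , λ { (fwd (_ , _ , leftmost)) → first-least f-first (leftmost f (proj₁ (K-left Kf)))
        ; (bwd (u-not-first , uv , leftmost)) → ⊥-elim (not-parent u-not-first uv leftmost) }
    where
    v-not-first : ¬ IsFirst σ v
    v-not-first v-first = first-minimal v-first (proj₂ (K-left Kf))

    not-parent : ∀ {u} → ¬ IsFirst σ u → Adj u v → ¬ (∀ w → Adj u w → ¬ Precedes σ w v)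
    not-parent u-not-first uv leftmost with dominating (symm uv)
    ... | inj₁ Ku = leftmost f (K-clique Ku Kf λ { refl → u-not-first f-first }) (proj₂ (K-left Kf))
    ... | inj₂ (w , Kw , uw) = leftmost w uw (proj₂ (K-left Kw))

theorem10 : {V : Set} {n : ℕ} → Fin n ↔ V → 2 ≤ n →
    (G : Graph V) → Connected G → Chordal G →
    (v : V) →
    (∃[ σ ] (IsPEO G {n} σ × IsFBranchLeaf G {n} σ v)) ⇔ HasDominatingClique (induced G (N G v))
theorem10 {V} {n} ι (s≤s (s≤s _)) G conn chordal v = mk⇔
  (λ (σ , peo , leaf) → OrderedGraph.leaf⇒dominating-clique G σ peo (first-first σ) conn leaf)
  backward
  where
  open Graph G using (Adj; symm; irrefl)
  open FiniteGraph (inj⇒≟ (↔⇒↣ (↔-sym ι))) G using (clique-first-PEO)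

  first-first : (σ : Ordering V n) → IsFirst σ (Inverse.to σ zero)
  first-first σ = cong toℕ (Inverse.strictlyInverseʳ σ zero)

  -- The vertices at the first two places of `ι` are distinct, and walks lead from `v` to both. The
  -- neighbour found makes `K` nonempty, by domination.
  has-neighbor : ∃[ u ] Adj v u
  has-neighbor = outgoing (conn v _) (conn v _) (to-zero≢to-one ∘ Injection.injective (↔⇒↣ ι))
    where
    to-zero≢to-one : _≢_ {A = Fin n} zero (suc zero)
    to-zero≢to-one ()

  backward : HasDominatingClique (induced G (N G v)) →
             ∃[ σ ] (IsPEO G {n} σ × IsFBranchLeaf G {n} σ v)
  backward (C , C-clique , C-dominating) = conclude (clique-first-PEO chordal K? K-clique ι)
    where
    -- This is `C` as a vertex set of `G`. A vertex of the induced graph carries its adjacency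
    -- proof, so deciding membership relies on that proof being irrelevant.
    K : Pred V 0ℓ
    K w = Σ (Adj v w) λ vw → T (C (w , vw))

    K? : Decidable K
    K? w with T? (Graph.adj G v w)
    ... | no v≁w = no (v≁w ∘ proj₁)
    ... | yes vw = map′ (vw ,_) (λ (vw′ , c) → subst (λ e → T (C (w , e))) (T-irrelevant vw′ vw) c)
                        (T? (C (w , vw)))

    K-clique : IsClique G K
    K-clique (_ , Cx) (_ , Cy) x≢y = C-clique Cx Cy (x≢y ∘ cong proj₁)

    v∉K : ¬ K v
    v∉K (vv , _) = irrefl vv

    dominating : ∀ {u} → Adj v u → K u ⊎ ∃[ w ] (K w × Adj u w)
    dominating {u} vu with C-dominating (u , vu)
    ... | inj₁ Cu = inj₁ (vu , Cu)
    ... | inj₂ ((w , vw) , Cw , uw) = inj₂ (w , (vw , Cw) , uw)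

    K-nonempty : ∃[ w ] K w
    K-nonempty with dominating (proj₂ has-neighbor)
    ... | inj₁ Ku = _ , Ku
    ... | inj₂ (w , Kw , _) = w , Kw

    conclude : ∃[ σ ] (IsPEO G {n} σ × (∀ {w u} → K w → ¬ K u → Precedes σ w u)) →
               ∃[ σ ] (IsPEO G {n} σ × IsFBranchLeaf G {n} σ v)
    conclude (σ , peo , K-first) =
        σ , peo
      , OrderedGraph.dominating-clique-first⇒leaf G σ K-clique (first-first σ) first∈K
          (λ Kw → proj₁ Kw , K-first Kw v∉K) dominating
      where
      -- Otherwise some member of the nonempty `K` would precede the first vertex.
      first∈K : K (Inverse.to σ zero)
      first∈K = decidable-stable (K? _) λ first∉K →
        OrderedGraph.first-minimal G σ (first-first σ) (K-first (proj₂ K-nonempty) first∉K)
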